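{- Let $d(x),g(x)\in\mathbb{Z}[x]$ be non-zero polynomials with $\gcd(d(x),g(x))=1$ and $\deg(g)<\deg(d)$, and let $(\mathcal{F}_n(x))_{n\ge 0}$ be the Fibonacci-type polynomial sequence determined by $d(x)$ and $g(x)$. Let $m(x)$ be a polynomial in $\mathbb{Z}[x]$ and let $p$ be an odd number. If $g(x)=-m(x)^2$, then $\mathcal{F}_p(x)$ is reducible over $\mathbb{Q}$.
   Context: The Fibonacci-type polynomial sequence determined by $d(x),g(x)$ is defined by $\mathcal{F}_0(x)=0$, $\mathcal{F}_1(x)=1$, and $\mathcal{F}_n(x)=d(x)\mathcal{F}_{n-1}(x)+g(x)\mathcal{F}_{n-2}(x)$ for $n\ge 2$.
   Formalization: The odd number p is required to be greater than 1, because for p = 1 the polynomial F_1(x) = 1 is a unit and hence is not reducible over Q. -}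

module Defs where

open import Level using (Level; _⊔_; 0ℓ)
open import Algebra.Bundles.Raw using (RawRing; RawSemiring)
open import Data.Integer.Base as ℤ using ()
open import Data.List.Base as List using (List; []; _∷_)
open import Data.Nat.Base using (ℕ; zero; suc; _<_)
open import Data.Product.Base using (_×_; ∃₂)
open import Data.Rational.Base as ℚ using ()
open import Data.Rational.Literals using (fromℤ)
import Algebra.Definitions.RawSemiring as SemiringDefinitions

module Polynomials {c ℓ : Level} (R : RawRing c ℓ) where

  open RawRing R

  -- Coefficients are listed in ascending order; trailing zeros are allowed,
  -- so polynomials are compared coefficientwise by _≈ₚ_ and not by _≡_.
  Poly : Set c
  Poly = List Carrier

  coeff : Poly → ℕ → Carrier
  coeff []      _       = 0#
  coeff (a ∷ f) zero    = a
  coeff (a ∷ f) (suc n) = coeff f n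

  infix 4 _≈ₚ_
  _≈ₚ_ : Poly → Poly → Set ℓ
  f ≈ₚ g = ∀ n → coeff f n ≈ coeff g n

  infixl 6 _+ₚ_
  _+ₚ_ : Poly → Poly → Poly
  []      +ₚ g       = g
  (a ∷ f) +ₚ []      = a ∷ f
  (a ∷ f) +ₚ (b ∷ g) = (a + b) ∷ (f +ₚ g)

  infixl 7 _*ₚ_
  _*ₚ_ : Poly → Poly → Poly
  []      *ₚ g = []
  (a ∷ f) *ₚ g = List.map (a *_) g +ₚ (0# ∷ (f *ₚ g))

  polynomialRing : RawRing c ℓ
  polynomialRing = record
    { Carrier = Poly
    ; _≈_     = _≈ₚ_
    ; _+_     = _+ₚ_
    ; _*_     = _*ₚ_
    ; -_      = List.map (-_)
    ; 0#      = []
    ; 1#      = 1# ∷ []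
    }

  -- The zero polynomial has no degree.
  HasDegree : Poly → ℕ → Set ℓ
  HasDegree f n = (coeff f n ≉ 0#) × (∀ k → n < k → coeff f k ≈ 0#)

module _ {c ℓ : Level} (S : RawSemiring c ℓ) where

  open RawSemiring S
  open SemiringDefinitions S using (_∤_)

  -- _∤ 1# says "is not a unit".
  Reducible : Carrier → Set (c ⊔ ℓ)
  Reducible f =
    (f ≉ 0#) × (f ∤ 1#) × ∃₂ λ a b → (f ≈ a * b) × (a ∤ 1#) × (b ∤ 1#)

ℤ[X] ℚ[X] : RawRing 0ℓ 0ℓ
ℤ[X] = Polynomials.polynomialRing ℤ.+-*-rawRing
ℚ[X] = Polynomials.polynomialRing ℚ.+-*-rawRing

open RawRing ℤ[X] public
  using (_≈_; _≉_; _+_; _*_; -_; 0#; 1#)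
  renaming (Carrier to Polyℤ)
open SemiringDefinitions (RawRing.rawSemiring ℤ[X]) public using (Coprime)
open Polynomials ℤ.+-*-rawRing public using (HasDegree)

toℚ[X] : Polyℤ → RawRing.Carrier ℚ[X]
toℚ[X] = List.map fromℤ

ReducibleOverℚ : Polyℤ → Set
ReducibleOverℚ f = Reducible (RawRing.rawSemiring ℚ[X]) (toℚ[X] f)

𝓕 : Polyℤ → Polyℤ → ℕ → Polyℤ
𝓕 d g zero          = 0#
𝓕 d g (suc zero)    = 1#
𝓕 d g (suc (suc n)) = d * 𝓕 d g (suc n) + g * 𝓕 d g n

{-# OPTIONS --safe #-}

-- The addition formula for 𝓕 gives 𝓕₂ₖ₊₁ = 𝓕ₖ₊₁² + g 𝓕ₖ², which for g = −m² is
-- the difference of squares (𝓕ₖ₊₁ + m 𝓕ₖ)(𝓕ₖ₊₁ − m 𝓕ₖ).  Put D = deg d.  From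
-- deg g < D it follows that deg 𝓕ₖ₊₁ = k D and deg m < D, so m 𝓕ₖ has degree
-- below k D: both factors have degree k D > 0 and are not units.

module Submission where

open import Defs using (module Polynomials)
open import Algebra.Bundles using (CommutativeRing; CommutativeSemigroup)
open import Algebra.Bundles.Raw using (RawRing)
import Algebra.Definitions.RawSemiring as SemiringDefinitions
import Algebra.Properties.CommutativeSemigroup as CommutativeSemigroupProperties
import Algebra.Properties.Ring as RingProperties
import Algebra.Solver.Ring.NaturalCoefficients.Default as SemiringSolver
open import Data.Integer.Base using (0ℤ)
import Data.Integer.Base as ℤ
import Data.Integer.Properties as ℤ
open import Data.List.Base as List using ([]; _∷_)
open import Data.List.Properties using (map-∘; map-cong)
open import Data.Nat.Base using (ℕ; zero; suc; _<_; _≤_; z≤n; s≤s)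
import Data.Nat.Base as ℕ
open import Data.Nat.Divisibility using (_∣_; divides; ∣m∣n⇒∣m+n; ∣-refl)
import Data.Nat.Properties as ℕ
open import Data.Product.Base using (_,_; ∃; proj₁; proj₂)
open import Data.Rational.Base using (0ℚ)
import Data.Rational.Base as ℚ
open import Data.Rational.Literals using (fromℤ)
import Data.Rational.Properties as ℚ
import Data.Rational.Unnormalised.Base as ℚᵘ
import Data.Rational.Unnormalised.Properties as ℚᵘ
open import Data.Sum.Base using (_⊎_; inj₁; inj₂; [_,_]′)
open import Level using (Level)
open import Relation.Binary.Bundles using (Setoid)
open import Relation.Binary.PropositionalEquality as ≡ using (_≡_; module ≡-Reasoning)
import Relation.Binary.Reasoning.Setoid as SetoidReasoning
open import Relation.Nullary.Decidable.Core using (Dec; yes; no)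
open import Relation.Nullary.Negation.Core using (¬_; contradiction)

private
  variable
    c ℓ : Level

-- Commutative ring structure on coefficient lists.

module PolynomialRing (R : CommutativeRing c ℓ) where

  open CommutativeRing R
  open Polynomials rawRing
  open RingProperties ring using (-0#≈0#)

  infixr 7 _·_
  _·_ : Carrier → Poly → Poly
  a · f = List.map (a *_) f

  coeff-+ : ∀ f g n → coeff (f +ₚ g) n ≈ coeff f n + coeff g n
  coeff-+ []      g       n       = sym (+-identityˡ _)
  coeff-+ (a ∷ f) []      n       = sym (+-identityʳ _)
  coeff-+ (a ∷ f) (b ∷ g) zero    = refl
  coeff-+ (a ∷ f) (b ∷ g) (suc n) = coeff-+ f g n

  coeff-· : ∀ a f n → coeff (a · f) n ≈ a * coeff f n
  coeff-· a []      n       = sym (zeroʳ a)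
  coeff-· a (b ∷ f) zero    = refl
  coeff-· a (b ∷ f) (suc n) = coeff-· a f n

  coeff-neg : ∀ f n → coeff (List.map (-_) f) n ≈ - coeff f n
  coeff-neg []      n       = sym -0#≈0#
  coeff-neg (a ∷ f) zero    = refl
  coeff-neg (a ∷ f) (suc n) = coeff-neg f n

  -- Being a function type, f ≈ₚ g does not determine f and g; the record does.
  infix 4 _≋_
  record _≋_ (f g : Poly) : Set ℓ where
    constructor coeffwise
    field
      coeffs : f ≈ₚ g
  open _≋_ public

  ≋-setoid : Setoid c ℓ
  ≋-setoid = record
    { Carrier       = Poly
    ; _≈_           = _≋_
    ; isEquivalence = record
      { refl  = coeffwise λ _ → refl
      ; sym   = λ p → coeffwise λ n → sym (coeffs p n)
      ; trans = λ p q → coeffwise λ n → trans (coeffs p n) (coeffs q n)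
      }
    }

  open Setoid ≋-setoid public using ()
    renaming (refl to ≋-refl; sym to ≋-sym; trans to ≋-trans; isEquivalence to ≋-isEquivalence)

  ∷-cong : ∀ {a b f g} → a ≈ b → f ≋ g → (a ∷ f) ≋ (b ∷ g)
  ∷-cong p q = coeffwise λ { zero → p ; (suc n) → coeffs q n }

  ∷-zero : ∀ {a f} → a ≈ 0# → f ≋ [] → (a ∷ f) ≋ []
  ∷-zero p q = coeffwise λ { zero → p ; (suc n) → coeffs q n }

  +ₚ-cong : ∀ {f f′ g g′} → f ≋ f′ → g ≋ g′ → f +ₚ g ≋ f′ +ₚ g′
  +ₚ-cong {f} {f′} {g} {g′} p q = coeffwise λ n →
    trans (coeff-+ f g n) (trans (+-cong (coeffs p n) (coeffs q n)) (sym (coeff-+ f′ g′ n)))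

  +ₚ-assoc : ∀ f g h → (f +ₚ g) +ₚ h ≋ f +ₚ (g +ₚ h)
  +ₚ-assoc f g h = coeffwise λ n → begin
    coeff ((f +ₚ g) +ₚ h) n                 ≈⟨ coeff-+ (f +ₚ g) h n ⟩
    coeff (f +ₚ g) n + coeff h n            ≈⟨ +-congʳ (coeff-+ f g n) ⟩
    (coeff f n + coeff g n) + coeff h n     ≈⟨ +-assoc _ _ _ ⟩
    coeff f n + (coeff g n + coeff h n)     ≈⟨ +-congˡ (coeff-+ g h n) ⟨
    coeff f n + coeff (g +ₚ h) n            ≈⟨ coeff-+ f (g +ₚ h) n ⟨
    coeff (f +ₚ (g +ₚ h)) n                 ∎
    where open SetoidReasoning setoid

  +ₚ-comm : ∀ f g → f +ₚ g ≋ g +ₚ f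
  +ₚ-comm f g = coeffwise λ n → trans (coeff-+ f g n) (trans (+-comm _ _) (sym (coeff-+ g f n)))

  +ₚ-identityʳ : ∀ f → f +ₚ [] ≋ f
  +ₚ-identityʳ f = +ₚ-comm f []

  -ₚ‿inverseˡ : ∀ f → List.map (-_) f +ₚ f ≋ []
  -ₚ‿inverseˡ f = coeffwise λ n →
    trans (coeff-+ (List.map (-_) f) f n) (trans (+-congʳ (coeff-neg f n)) (-‿inverseˡ _))

  -ₚ‿cong : ∀ {f g} → f ≋ g → List.map (-_) f ≋ List.map (-_) g
  -ₚ‿cong {f} {g} p = coeffwise λ n → trans (coeff-neg f n) (trans (-‿cong (coeffs p n)) (sym (coeff-neg g n)))

  +ₚ-commutativeSemigroup : CommutativeSemigroup c ℓ
  +ₚ-commutativeSemigroup = record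
    { _∙_ = _+ₚ_
    ; isCommutativeSemigroup = record
      { isSemigroup = record
        { isMagma = record { isEquivalence = ≋-isEquivalence ; ∙-cong = +ₚ-cong }
        ; assoc   = +ₚ-assoc
        }
      ; comm = +ₚ-comm
      }
    }

  private
    module +P = CommutativeSemigroupProperties +ₚ-commutativeSemigroup

  ·-cong : ∀ {a b f g} → a ≈ b → f ≋ g → a · f ≋ b · g
  ·-cong {a} {b} {f} {g} p q = coeffwise λ n →
    trans (coeff-· a f n) (trans (*-cong p (coeffs q n)) (sym (coeff-· b g n)))

  ·-distribˡ-+ₚ : ∀ a f g → a · (f +ₚ g) ≋ a · f +ₚ a · g
  ·-distribˡ-+ₚ a f g = coeffwise λ n → begin
    coeff (a · (f +ₚ g)) n             ≈⟨ coeff-· a (f +ₚ g) n ⟩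
    a * coeff (f +ₚ g) n               ≈⟨ *-congˡ (coeff-+ f g n) ⟩
    a * (coeff f n + coeff g n)        ≈⟨ distribˡ _ _ _ ⟩
    a * coeff f n + a * coeff g n      ≈⟨ +-cong (coeff-· a f n) (coeff-· a g n) ⟨
    coeff (a · f) n + coeff (a · g) n  ≈⟨ coeff-+ (a · f) (a · g) n ⟨
    coeff (a · f +ₚ a · g) n           ∎
    where open SetoidReasoning setoid

  ·-distribʳ-+ : ∀ f a b → (a + b) · f ≋ a · f +ₚ b · f
  ·-distribʳ-+ f a b = coeffwise λ n → begin
    coeff ((a + b) · f) n              ≈⟨ coeff-· (a + b) f n ⟩
    (a + b) * coeff f n                ≈⟨ distribʳ _ _ _ ⟩
    a * coeff f n + b * coeff f n      ≈⟨ +-cong (coeff-· a f n) (coeff-· b f n) ⟨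
    coeff (a · f) n + coeff (b · f) n  ≈⟨ coeff-+ (a · f) (b · f) n ⟨
    coeff (a · f +ₚ b · f) n           ∎
    where open SetoidReasoning setoid

  ·-assoc : ∀ a b f → (a * b) · f ≋ a · b · f
  ·-assoc a b f = coeffwise λ n → begin
    coeff ((a * b) · f) n  ≈⟨ coeff-· (a * b) f n ⟩
    (a * b) * coeff f n    ≈⟨ *-assoc _ _ _ ⟩
    a * (b * coeff f n)    ≈⟨ *-congˡ (coeff-· b f n) ⟨
    a * coeff (b · f) n    ≈⟨ coeff-· a (b · f) n ⟨
    coeff (a · b · f) n    ∎
    where open SetoidReasoning setoid

  ·-zeroˡ : ∀ {a} f → a ≈ 0# → a · f ≋ []
  ·-zeroˡ {a} f p = coeffwise λ n → trans (coeff-· a f n) (trans (*-congʳ p) (zeroˡ _))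

  ·-identityˡ : ∀ f → 1# · f ≋ f
  ·-identityˡ f = coeffwise λ n → trans (coeff-· 1# f n) (*-identityˡ _)

  *ₚ-zeroʳ : ∀ f → f *ₚ [] ≋ []
  *ₚ-zeroʳ []      = ≋-refl
  *ₚ-zeroʳ (a ∷ f) = ∷-zero refl (*ₚ-zeroʳ f)

  -- The product recurses on its left factor only; this is the matching recursion on the right
  -- factor, which commutativity needs.
  *ₚ-∷ʳ : ∀ f b g → f *ₚ (b ∷ g) ≋ b · f +ₚ (0# ∷ f *ₚ g)
  *ₚ-∷ʳ []      b g = ≋-sym (∷-zero refl ≋-refl)
  *ₚ-∷ʳ (a ∷ f) b g = ∷-cong (+-congʳ (*-comm a b)) (begin
    a · g +ₚ f *ₚ (b ∷ g)              ≈⟨ +ₚ-cong {a · g} ≋-refl (*ₚ-∷ʳ f b g) ⟩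
    a · g +ₚ (b · f +ₚ (0# ∷ f *ₚ g))  ≈⟨ +P.x∙yz≈y∙xz (a · g) (b · f) (0# ∷ f *ₚ g) ⟩
    b · f +ₚ (a · g +ₚ (0# ∷ f *ₚ g))  ∎)
    where open SetoidReasoning ≋-setoid

  *ₚ-comm : ∀ f g → f *ₚ g ≋ g *ₚ f
  *ₚ-comm []      g = ≋-sym (*ₚ-zeroʳ g)
  *ₚ-comm (a ∷ f) g = ≋-trans
    (+ₚ-cong {a · g} ≋-refl (∷-cong refl (*ₚ-comm f g)))
    (≋-sym (*ₚ-∷ʳ g a f))

  *ₚ-congˡ : ∀ f {g g′} → g ≋ g′ → f *ₚ g ≋ f *ₚ g′
  *ₚ-congˡ []      p = ≋-refl
  *ₚ-congˡ (a ∷ f) p = +ₚ-cong (·-cong refl p) (∷-cong refl (*ₚ-congˡ f p))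

  -- Equal polynomials may have lists of different lengths, which obstructs a direct induction on
  -- the left factor; commutativity carries the change to the right, where `*ₚ-congˡ` applies.
  *ₚ-cong : ∀ {f f′ g g′} → f ≋ f′ → g ≋ g′ → f *ₚ g ≋ f′ *ₚ g′
  *ₚ-cong {f} {f′} {g} {g′} p q = begin
    f *ₚ g    ≈⟨ *ₚ-congˡ f q ⟩
    f *ₚ g′   ≈⟨ *ₚ-comm f g′ ⟩
    g′ *ₚ f   ≈⟨ *ₚ-congˡ g′ p ⟩
    g′ *ₚ f′  ≈⟨ *ₚ-comm g′ f′ ⟩
    f′ *ₚ g′  ∎
    where open SetoidReasoning ≋-setoid

  *ₚ-distribʳ-+ₚ : ∀ h f g → (f +ₚ g) *ₚ h ≋ f *ₚ h +ₚ g *ₚ h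
  *ₚ-distribʳ-+ₚ h []      g       = ≋-refl
  *ₚ-distribʳ-+ₚ h (a ∷ f) []      = ≋-sym (+ₚ-identityʳ ((a ∷ f) *ₚ h))
  *ₚ-distribʳ-+ₚ h (a ∷ f) (b ∷ g) = begin
    (a + b) · h +ₚ (0# ∷ (f +ₚ g) *ₚ h)
      ≈⟨ +ₚ-cong (·-distribʳ-+ h a b)
           -- `0#` is split as `0# + 0#`, so that the shifted product becomes a sum of two shifted
           -- lists.
           (∷-cong (sym (+-identityˡ 0#)) (*ₚ-distribʳ-+ₚ h f g)) ⟩
    (a · h +ₚ b · h) +ₚ ((0# ∷ f *ₚ h) +ₚ (0# ∷ g *ₚ h))
      ≈⟨ +P.interchange (a · h) (b · h) (0# ∷ f *ₚ h) (0# ∷ g *ₚ h) ⟩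
    (a · h +ₚ (0# ∷ f *ₚ h)) +ₚ (b · h +ₚ (0# ∷ g *ₚ h)) ∎
    where open SetoidReasoning ≋-setoid

  ·-*ₚ-assoc : ∀ a f g → (a · f) *ₚ g ≋ a · (f *ₚ g)
  ·-*ₚ-assoc a []      g = ≋-refl
  ·-*ₚ-assoc a (b ∷ f) g = begin
    (a * b) · g +ₚ (0# ∷ (a · f) *ₚ g)
      ≈⟨ +ₚ-cong (·-assoc a b g) (∷-cong (sym (zeroʳ a)) (·-*ₚ-assoc a f g)) ⟩
    a · b · g +ₚ a · (0# ∷ f *ₚ g)
      ≈⟨ ·-distribˡ-+ₚ a (b · g) (0# ∷ f *ₚ g) ⟨
    a · (b · g +ₚ (0# ∷ f *ₚ g)) ∎
    where open SetoidReasoning ≋-setoid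

  *ₚ-assoc : ∀ f g h → (f *ₚ g) *ₚ h ≋ f *ₚ (g *ₚ h)
  *ₚ-assoc []      g h = ≋-refl
  *ₚ-assoc (a ∷ f) g h = begin
    (a · g +ₚ (0# ∷ f *ₚ g)) *ₚ h
      ≈⟨ *ₚ-distribʳ-+ₚ h (a · g) (0# ∷ f *ₚ g) ⟩
    (a · g) *ₚ h +ₚ (0# · h +ₚ (0# ∷ (f *ₚ g) *ₚ h))
      -- The summand `0# · h`, left by unfolding `(0# ∷ f *ₚ g) *ₚ h`, vanishes.
      ≈⟨ +ₚ-cong (·-*ₚ-assoc a g h)
           (+ₚ-cong (·-zeroˡ h refl) (∷-cong refl (*ₚ-assoc f g h))) ⟩
    a · (g *ₚ h) +ₚ (0# ∷ f *ₚ (g *ₚ h)) ∎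
    where open SetoidReasoning ≋-setoid

  *ₚ-identityˡ : ∀ f → (1# ∷ []) *ₚ f ≋ f
  *ₚ-identityˡ f = begin
    1# · f +ₚ (0# ∷ [])  ≈⟨ +ₚ-cong (·-identityˡ f) (∷-zero refl ≋-refl) ⟩
    f +ₚ []              ≈⟨ +ₚ-identityʳ f ⟩
    f                    ∎
    where open SetoidReasoning ≋-setoid

  commutativeRing : CommutativeRing c ℓ
  commutativeRing = record
    { Carrier = Poly
    ; _≈_     = _≋_
    ; _+_     = _+ₚ_
    ; _*_     = _*ₚ_
    ; -_      = List.map (-_)
    ; 0#      = []
    ; 1#      = 1# ∷ []
    ; isCommutativeRing = record
      { isRing = record
        { +-isAbelianGroup = record
          { isGroup = record
            { isMonoid = record
              { isSemigroup = CommutativeSemigroup.isSemigroup +ₚ-commutativeSemigroup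
              ; identity    = (λ _ → ≋-refl) , +ₚ-identityʳ
              }
            ; inverse = -ₚ‿inverseˡ , λ f → ≋-trans (+ₚ-comm f (List.map (-_) f)) (-ₚ‿inverseˡ f)
            ; ⁻¹-cong = -ₚ‿cong
            }
          ; comm = +ₚ-comm
          }
        ; *-cong     = *ₚ-cong
        ; *-assoc    = *ₚ-assoc
        ; *-identity = *ₚ-identityˡ , λ f → ≋-trans (*ₚ-comm f (1# ∷ [])) (*ₚ-identityˡ f)
        ; distrib    = distribˡ-*ₚ , *ₚ-distribʳ-+ₚ
        }
      ; *-comm = *ₚ-comm
      }
    }
    where
    open SetoidReasoning ≋-setoid
    distribˡ-*ₚ : ∀ h f g → h *ₚ (f +ₚ g) ≋ h *ₚ f +ₚ h *ₚ g
    distribˡ-*ₚ h f g = begin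
      h *ₚ (f +ₚ g)     ≈⟨ *ₚ-comm h (f +ₚ g) ⟩
      (f +ₚ g) *ₚ h     ≈⟨ *ₚ-distribʳ-+ₚ h f g ⟩
      f *ₚ h +ₚ g *ₚ h  ≈⟨ +ₚ-cong (*ₚ-comm f h) (*ₚ-comm g h) ⟩
      h *ₚ f +ₚ h *ₚ g  ∎

-- Degree bounds and exact degrees.

module Degree (R : CommutativeRing c ℓ) where

  open CommutativeRing R
  open Polynomials rawRing
  open PolynomialRing R
  open RingProperties ring using (-0#≈0#)

  -- Says deg `f` < `n`, where the zero polynomial satisfies every bound and is the only one to
  -- satisfy `n` = 0. As `n < k` is `suc n ≤ k`, the second half of `HasDegree f n` is literally
  -- `DegreeBelow (suc n) f`.
  DegreeBelow : ℕ → Poly → Set ℓ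
  DegreeBelow n f = ∀ k → n ≤ k → coeff f k ≈ 0#

  DegreeBelow-mono : ∀ {m n f} → m ≤ n → DegreeBelow m f → DegreeBelow n f
  DegreeBelow-mono m≤n p k n≤k = p k (ℕ.≤-trans m≤n n≤k)

  DegreeBelow-+ : ∀ {n f g} → DegreeBelow n f → DegreeBelow n g → DegreeBelow n (f +ₚ g)
  DegreeBelow-+ {f = f} {g} p q k n≤k =
    trans (coeff-+ f g k) (trans (+-cong (p k n≤k) (q k n≤k)) (+-identityˡ 0#))

  DegreeBelow-neg : ∀ {n f} → DegreeBelow n f → DegreeBelow n (List.map (-_) f)
  DegreeBelow-neg {f = f} p k n≤k =
    trans (coeff-neg f k) (trans (-‿cong (p k n≤k)) -0#≈0#)

  -- When two indices sum to at least `m + n`, the first is at least `m` or the second exceeds `n`,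
  -- so every product in the convolution has a zero factor.
  DegreeBelow-* : ∀ m n f g → DegreeBelow m f → DegreeBelow (suc n) g → DegreeBelow (m ℕ.+ n) (f *ₚ g)
  DegreeBelow-* m n []      g p q k m+n≤k = refl
  DegreeBelow-* m n (a ∷ f) g p q k m+n≤k =
    trans (coeff-+ (a · g) (0# ∷ f *ₚ g) k)
      (trans (+-cong (trans (coeff-· a g k) (head m p m+n≤k)) (tail m p k m+n≤k)) (+-identityˡ 0#))
    where
    head : ∀ m → DegreeBelow m (a ∷ f) → m ℕ.+ n ≤ k → a * coeff g k ≈ 0#
    head zero    p n≤k   = trans (*-congʳ (p 0 z≤n)) (zeroˡ _)
    head (suc m) p m+n≤k =
      trans (*-congˡ (q k (ℕ.≤-trans (s≤s (ℕ.m≤n+m n m)) m+n≤k))) (zeroʳ a)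
    tail : ∀ m → DegreeBelow m (a ∷ f) → ∀ k → m ℕ.+ n ≤ k → coeff (0# ∷ f *ₚ g) k ≈ 0#
    tail m       p zero    _           = refl
    -- The bound 0 makes all of `a ∷ f` zero, so `f` contributes nothing.
    tail zero    p (suc k) _           = coeffs (*ₚ-cong {f} {[]} {g} (coeffwise λ j → p (suc j) z≤n) ≋-refl) k
    tail (suc m) p (suc k) (s≤s m+n≤k) = DegreeBelow-* m n f g (λ j m≤j → p (suc j) (s≤s m≤j)) q k m+n≤k

  -- Any other pair of indices with sum `m + n` has one index above its bound, so a single product
  -- survives the convolution.
  coeff-*-top : ∀ m n f g → DegreeBelow (suc m) f → DegreeBelow (suc n) g →
    coeff (f *ₚ g) (m ℕ.+ n) ≈ coeff f m * coeff g n
  coeff-*-top m       n []      g p q = sym (zeroˡ _)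
  coeff-*-top zero    n (a ∷ f) g p q =
    trans (coeff-+ (a · g) (0# ∷ f *ₚ g) n)
      (trans (+-cong (coeff-· a g n) (coeffs (∷-zero refl fg≈0) n)) (+-identityʳ _))
    where
    fg≈0 : f *ₚ g ≋ []
    fg≈0 = *ₚ-cong {f} {[]} {g} (coeffwise λ j → p (suc j) (s≤s z≤n)) ≋-refl
  coeff-*-top (suc m) n (a ∷ f) g p q =
    trans (coeff-+ (a · g) (0# ∷ f *ₚ g) (suc m ℕ.+ n))
      (trans (+-cong ag≈0 (coeff-*-top m n f g (λ j m<j → p (suc j) (s≤s m<j)) q)) (+-identityˡ _))
    where
    ag≈0 : coeff (a · g) (suc m ℕ.+ n) ≈ 0#
    ag≈0 = trans (coeff-· a g _) (trans (*-congˡ (q _ (s≤s (ℕ.m≤n+m n m)))) (zeroʳ a))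

  HasDegree-cong : ∀ {f g n} → f ≋ g → HasDegree f n → HasDegree g n
  HasDegree-cong p (fₙ≉0 , below) =
    (λ gₙ≈0 → fₙ≉0 (trans (coeffs p _) gₙ≈0)) , λ k n<k → trans (sym (coeffs p k)) (below k n<k)

  HasDegree-neg : ∀ {f n} → HasDegree f n → HasDegree (List.map (-_) f) n
  HasDegree-neg {f} {n} (fₙ≉0 , below) =
    (λ -fₙ≈0 → fₙ≉0 (trans (sym (-‿involutive _))
      (trans (-‿cong (trans (sym (coeff-neg f n)) -fₙ≈0)) -0#≈0#)))
    , DegreeBelow-neg {f = f} below
    where open RingProperties ring using (-‿involutive)

  HasDegree-+ˡ : ∀ {f g n} → HasDegree f n → DegreeBelow n g → HasDegree (f +ₚ g) n
  HasDegree-+ˡ {f} {g} {n} (fₙ≉0 , below) q =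
    (λ f+gₙ≈0 → fₙ≉0 (begin
      coeff f n              ≈⟨ +-identityʳ _ ⟨
      coeff f n + 0#         ≈⟨ +-congˡ (q n ℕ.≤-refl) ⟨
      coeff f n + coeff g n  ≈⟨ coeff-+ f g n ⟨
      coeff (f +ₚ g) n       ≈⟨ f+gₙ≈0 ⟩
      0#                     ∎))
    , DegreeBelow-+ {f = f} {g} below (λ k n<k → q k (ℕ.<⇒≤ n<k))
    where open SetoidReasoning setoid

  -- Additivity of degrees and non-units over an integral domain.

  module IntegralDomain
    (≈0? : ∀ x → Dec (x ≈ 0#))
    (x*y≈0⇒x≈0∨y≈0 : ∀ x y → x * y ≈ 0# → x ≈ 0# ⊎ y ≈ 0#)
    where

    open SemiringDefinitions (RawRing.rawSemiring polynomialRing) using (_∤_)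

    -- With trailing zeros allowed, the length of the list does not give the degree; the tail is
    -- examined first, and the head matters only when the tail is zero.
    zero-or-degree : ∀ f → f ≋ [] ⊎ ∃ (HasDegree f)
    zero-or-degree []      = inj₁ ≋-refl
    zero-or-degree (a ∷ f) with zero-or-degree f | ≈0? a
    ... | inj₂ (n , fₙ≉0 , below) | _       = inj₂ (suc n , fₙ≉0 , λ { (suc k) (s≤s n<k) → below k n<k })
    ... | inj₁ f≈0                | yes a≈0 = inj₁ (∷-zero a≈0 f≈0)
    ... | inj₁ f≈0                | no  a≉0 = inj₂ (0 , a≉0 , λ { (suc k) _ → coeffs f≈0 k })

    -- The top coefficient is the product of the two leading coefficients, which is nonzero in the
    -- absence of zero divisors.
    HasDegree-* : ∀ {f g m n} → HasDegree f m → HasDegree g n → HasDegree (f *ₚ g) (m ℕ.+ n)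
    HasDegree-* {f} {g} {m} {n} (fₘ≉0 , p) (gₙ≉0 , q) =
      (λ fg≈0 → [ fₘ≉0 , gₙ≉0 ]′
        (x*y≈0⇒x≈0∨y≈0 _ _ (trans (sym (coeff-*-top m n f g p q)) fg≈0)))
      , DegreeBelow-* (suc m) n f g p q

    -- A nonzero cofactor `q` would give `q *ₚ f` a positive degree, where the constant 1 has
    -- coefficient zero.
    positive-degree⇒∤1 : ∀ {f n} → 0 < n → HasDegree f n → f ∤ (1# ∷ [])
    positive-degree⇒∤1 {f} {suc n} _ deg-f@(fₙ≉0 , _) record { quotient = q ; equality = qf≈1 } with zero-or-degree q
    -- A zero cofactor identifies `1#` with `0#`, which then annihilates the leading coefficient of
    -- `f`.
    ... | inj₁ q≈0 = fₙ≉0 (begin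
      coeff f (suc n)       ≈⟨ *-identityˡ _ ⟨
      1# * coeff f (suc n)  ≈⟨ *-congʳ (qf≈1 0) ⟨
      coeff (q *ₚ f) 0 * coeff f (suc n)
        ≈⟨ *-congʳ (coeffs (*ₚ-cong q≈0 (≋-refl {f})) 0) ⟩
      0# * coeff f (suc n)  ≈⟨ zeroˡ _ ⟩
      0#                    ∎)
      where open SetoidReasoning setoid
    -- The degree `k + suc n` is rewritten as a successor, where the coefficient of `1# ∷ []`
    -- computes to `0#`.
    ... | inj₂ (k , deg-q) = proj₁ (HasDegree-* {q} {f} deg-q deg-f)
      (≡.subst (λ j → coeff (q *ₚ f) j ≈ 0#) (≡.sym (ℕ.+-suc k n)) (qf≈1 (suc (k ℕ.+ n))))

open import Defs

-- The embedding of ℤ[X] into ℚ[X].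

ℤ[X]-commutativeRing : CommutativeRing _ _
ℤ[X]-commutativeRing = PolynomialRing.commutativeRing ℤ.+-*-commutativeRing

module ℤ[X] = CommutativeRing ℤ[X]-commutativeRing
open PolynomialRing ℤ.+-*-commutativeRing using (_≋_; coeffwise; coeffs)
module ℤDegree = Degree ℤ.+-*-commutativeRing
module ℚDegree = Degree ℚ.+-*-commutativeRing

-- Addition in ℚ normalises its result, so the comparison is made between unnormalised rationals,
-- where the sum has numerator `i * 1 + j * 1` and denominator 1.
fromℤ-homo-+ : ∀ i j → fromℤ (i ℤ.+ j) ≡ fromℤ i ℚ.+ fromℤ j
fromℤ-homo-+ i j = ℚ.toℚᵘ-injective (ℚᵘ.≃-trans
  (ℚᵘ.≃-reflexive (≡.cong (λ k → ℚᵘ.mkℚᵘ k 0)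
    (≡.sym (≡.cong₂ ℤ._+_ (ℤ.*-identityʳ i) (ℤ.*-identityʳ j)))))
  (ℚᵘ.≃-sym (ℚ.toℚᵘ-homo-+ (fromℤ i) (fromℤ j))))

fromℤ-homo-* : ∀ i j → fromℤ (i ℤ.* j) ≡ fromℤ i ℚ.* fromℤ j
fromℤ-homo-* i j = ℚ.toℚᵘ-injective (ℚᵘ.≃-sym (ℚ.toℚᵘ-homo-* (fromℤ i) (fromℤ j)))

private
  module ℤₚ = Polynomials ℤ.+-*-rawRing
  module ℚₚ = Polynomials ℚ.+-*-rawRing

toℚ[X]-homo-+ : ∀ f g → toℚ[X] (f + g) ≡ toℚ[X] f ℚₚ.+ₚ toℚ[X] g
toℚ[X]-homo-+ []      g       = ≡.refl
toℚ[X]-homo-+ (a ∷ f) []      = ≡.refl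
toℚ[X]-homo-+ (a ∷ f) (b ∷ g) = ≡.cong₂ _∷_ (fromℤ-homo-+ a b) (toℚ[X]-homo-+ f g)

toℚ[X]-homo-* : ∀ f g → toℚ[X] (f * g) ≡ toℚ[X] f ℚₚ.*ₚ toℚ[X] g
toℚ[X]-homo-* []      g = ≡.refl
toℚ[X]-homo-* (a ∷ f) g = ≡.trans
  (toℚ[X]-homo-+ (List.map (a ℤ.*_) g) (0ℤ ∷ f * g))
  (≡.cong₂ (λ u v → u ℚₚ.+ₚ (0ℚ ∷ v)) scale (toℚ[X]-homo-* f g))
  where
  scale : toℚ[X] (List.map (a ℤ.*_) g) ≡ List.map (fromℤ a ℚ.*_) (toℚ[X] g)
  scale = ≡.trans (≡.sym (map-∘ g)) (≡.trans (map-cong (fromℤ-homo-* a) g) (map-∘ g))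

coeff-toℚ[X] : ∀ f n → ℚₚ.coeff (toℚ[X] f) n ≡ fromℤ (ℤₚ.coeff f n)
coeff-toℚ[X] []      n       = ≡.refl
coeff-toℚ[X] (a ∷ f) zero    = ≡.refl
coeff-toℚ[X] (a ∷ f) (suc n) = coeff-toℚ[X] f n

toℚ[X]-cong : ∀ {f g} → f ≋ g → toℚ[X] f ℚₚ.≈ₚ toℚ[X] g
toℚ[X]-cong {f} {g} p n =
  ≡.trans (coeff-toℚ[X] f n) (≡.trans (≡.cong fromℤ (coeffs p n)) (≡.sym (coeff-toℚ[X] g n)))

toℚ[X]-HasDegree : ∀ {f n} → HasDegree f n → ℚₚ.HasDegree (toℚ[X] f) n
toℚ[X]-HasDegree {f} {n} (fₙ≢0 , below) =
  -- The numerator of `fromℤ` is the original integer, so a coefficient that vanishes over ℚ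
  -- vanishes over ℤ.
  (λ eq → fₙ≢0 (≡.cong ℚ.↥_ (≡.trans (≡.sym (coeff-toℚ[X] f n)) eq)))
  , λ k n<k → ≡.trans (coeff-toℚ[X] f k) (≡.cong fromℤ (below k n<k))

p*q≡0⇒p≡0∨q≡0 : ∀ p q → p ℚ.* q ≡ 0ℚ → p ≡ 0ℚ ⊎ q ≡ 0ℚ
p*q≡0⇒p≡0∨q≡0 p q pq≡0 with p ℚ.≟ 0ℚ
... | yes p≡0 = inj₁ p≡0
... | no  p≢0 = inj₂ (begin
  q                    ≡⟨ ℚ.*-identityˡ q ⟨
  ℚ.1ℚ ℚ.* q           ≡⟨ ≡.cong (ℚ._* q) (ℚ.*-inverseˡ p) ⟨
  ℚ.1/ p ℚ.* p ℚ.* q   ≡⟨ ℚ.*-assoc (ℚ.1/ p) p q ⟩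
  ℚ.1/ p ℚ.* (p ℚ.* q) ≡⟨ ≡.cong (ℚ.1/ p ℚ.*_) pq≡0 ⟩
  ℚ.1/ p ℚ.* 0ℚ        ≡⟨ ℚ.*-zeroʳ (ℚ.1/ p) ⟩
  0ℚ                   ∎)
  where
  open ≡-Reasoning
  instance
    p-nonZero : ℚ.NonZero p
    p-nonZero = ℚ.≢-nonZero p≢0

module ℤDomain = ℤDegree.IntegralDomain (ℤ._≟ 0ℤ) (λ i j → ℤ.i*j≡0⇒i≡0∨j≡0 i {j})
module ℚDomain = ℚDegree.IntegralDomain (ℚ._≟ 0ℚ) p*q≡0⇒p≡0∨q≡0

-- Addition formula and factorisation at odd indices.

𝓕-+ : ∀ d g m n →
  𝓕 d g (suc (m ℕ.+ n)) ≋ 𝓕 d g (suc m) * 𝓕 d g (suc n) + g * (𝓕 d g m * 𝓕 d g n)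
𝓕-+ d g zero    n = ℤ[X].sym (begin
  1# * 𝓕 d g (suc n) + g * 0#  ≈⟨ ℤ[X].+-cong (ℤ[X].*-identityˡ (𝓕 d g (suc n))) (ℤ[X].zeroʳ g) ⟩
  𝓕 d g (suc n) + 0#           ≈⟨ ℤ[X].+-identityʳ (𝓕 d g (suc n)) ⟩
  𝓕 d g (suc n)                ∎)
  where open SetoidReasoning ℤ[X].setoid
𝓕-+ d g (suc m) n = begin
  𝓕 d g (suc (suc (m ℕ.+ n)))
    -- One unit moves from `m` to `n`, so the induction hypothesis is applied at `suc n`.
    ≡⟨ ≡.cong (λ k → 𝓕 d g (suc k)) (ℕ.+-suc m n) ⟨
  𝓕 d g (suc (m ℕ.+ suc n))
    ≈⟨ 𝓕-+ d g m (suc n) ⟩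
  𝓕 d g (suc m) * (d * 𝓕 d g (suc n) + g * 𝓕 d g n) + g * (𝓕 d g m * 𝓕 d g (suc n))
    -- The two sides expand the recurrence in opposite factors: `d :* v :+ g :* u` is `𝓕` at
    -- `n + 2`, and `d :* y :+ g :* x` is `𝓕` at `m + 2`.
    ≈⟨ solve 6 (λ d g x y u v →
         y :* (d :* v :+ g :* u) :+ g :* (x :* v) := (d :* y :+ g :* x) :* v :+ g :* (y :* u))
         ℤ[X].refl d g (𝓕 d g m) (𝓕 d g (suc m)) (𝓕 d g n) (𝓕 d g (suc n)) ⟩
  𝓕 d g (suc (suc m)) * 𝓕 d g (suc n) + g * (𝓕 d g (suc m) * 𝓕 d g n) ∎
  where
  open SetoidReasoning ℤ[X].setoid
  open SemiringSolver ℤ[X].commutativeSemiring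

difference-of-squares : ∀ x y → x * x + - (y * y) ≋ (x + y) * (x + - y)
difference-of-squares x y = ℤ[X].sym (begin
  (x + y) * (x + - y)
    -- `- y` enters this semiring identity as an independent variable `n`; the cross terms collect
    -- into `x * (y + - y)`, which vanishes in the next step.
    ≈⟨ solve 3 (λ x y n → (x :+ y) :* (x :+ n) := x :* x :+ y :* n :+ x :* (y :+ n))
         ℤ[X].refl x y (- y) ⟩
  x * x + y * - y + x * (y + - y)
    ≈⟨ ℤ[X].+-cong (ℤ[X].+-congˡ {x * x} (ℤ[X].sym (-‿distribʳ-* y y)))
         (ℤ[X].trans (ℤ[X].*-congˡ {x} (ℤ[X].-‿inverseʳ y)) (ℤ[X].zeroʳ x)) ⟩
  x * x + - (y * y) + 0#
    ≈⟨ ℤ[X].+-identityʳ (x * x + - (y * y)) ⟩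
  x * x + - (y * y) ∎)
  where
  open SetoidReasoning ℤ[X].setoid
  open SemiringSolver ℤ[X].commutativeSemiring
  open RingProperties ℤ[X].ring using (-‿distribʳ-*)

𝓕-odd-factorisation : ∀ d g m k → g ≋ - (m * m) →
  𝓕 d g (suc (k ℕ.+ k)) ≋ (𝓕 d g (suc k) + m * 𝓕 d g k) * (𝓕 d g (suc k) + - (m * 𝓕 d g k))
𝓕-odd-factorisation d g m k g≈-m² = begin
  𝓕 d g (suc (k ℕ.+ k))
    ≈⟨ 𝓕-+ d g k k ⟩
  y * y + g * (x * x)
    ≈⟨ ℤ[X].+-congˡ {y * y} (ℤ[X].*-congʳ {x * x} g≈-m²) ⟩
  y * y + - (m * m) * (x * x)
    ≈⟨ ℤ[X].+-congˡ {y * y} (-‿distribˡ-* (m * m) (x * x)) ⟨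
  y * y + - (m * m * (x * x))
    ≈⟨ ℤ[X].+-congˡ {y * y} (ℤ[X].-‿cong
         (solve 2 (λ m x → m :* m :* (x :* x) := m :* x :* (m :* x)) ℤ[X].refl m x)) ⟩
  y * y + - (m * x * (m * x))
    ≈⟨ difference-of-squares y (m * x) ⟩
  (y + m * x) * (y + - (m * x)) ∎
  where
  x y : Polyℤ
  x = 𝓕 d g k
  y = 𝓕 d g (suc k)
  open SetoidReasoning ℤ[X].setoid
  open SemiringSolver ℤ[X].commutativeSemiring
  open RingProperties ℤ[X].ring using (-‿distribˡ-*)

-- Degrees of the sequence and of the square root.

open ℤDegree
  using (DegreeBelow; DegreeBelow-mono; DegreeBelow-neg; DegreeBelow-*
        ; HasDegree-cong; HasDegree-neg; HasDegree-+ˡ)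
open ℤDomain using (HasDegree-*; zero-or-degree)

mutual
  -- `d * 𝓕 d g (suc n)` has degree exactly `D + n * D`, and the other summand of the recurrence
  -- stays strictly below it because deg `g` < `D`.
  𝓕-HasDegree : ∀ {d g D} → HasDegree d D → DegreeBelow D g →
    ∀ n → HasDegree (𝓕 d g (suc n)) (n ℕ.* D)
  𝓕-HasDegree         deg-d deg-g zero    = (λ ()) , λ { (suc k) _ → ≡.refl }
  𝓕-HasDegree {d} {g} deg-d deg-g (suc n) =
    HasDegree-+ˡ {d * 𝓕 d g (suc n)} {g * 𝓕 d g n}
      (HasDegree-* {d} {𝓕 d g (suc n)} deg-d (𝓕-HasDegree deg-d deg-g n))
      (DegreeBelow-* _ _ g (𝓕 d g n) deg-g (𝓕-DegreeBelow deg-d deg-g n))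

  -- `𝓕 d g 0` is zero and has no degree, so the recurrence uses a bound that covers it too. At
  -- positive indices it exceeds the true degree by `D`, which the strict bound on `g` still
  -- tolerates.
  𝓕-DegreeBelow : ∀ {d g D} → HasDegree d D → DegreeBelow D g →
    ∀ n → DegreeBelow (suc (n ℕ.* D)) (𝓕 d g n)
  𝓕-DegreeBelow             deg-d deg-g zero    = λ _ _ → ≡.refl
  𝓕-DegreeBelow {d} {g} {D} deg-d deg-g (suc n) =
    DegreeBelow-mono {f = 𝓕 d g (suc n)} (s≤s (ℕ.m≤n+m (n ℕ.* D) D))
      (proj₂ (𝓕-HasDegree deg-d deg-g n))

-- If `m` had degree `e ≥ D`, then `- (m * m)` would have degree `e + e ≥ D`, contrary to the bound
-- on `g`.
square-root-DegreeBelow : ∀ {g m D} → g ≋ - (m * m) → DegreeBelow D g → DegreeBelow D m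
square-root-DegreeBelow {g} {m} {D} g≈-m² deg-g with zero-or-degree m
... | inj₁ m≈0         = λ k _ → coeffs m≈0 k
... | inj₂ (e , deg-m) with e ℕ.<? D
...   | yes e<D = DegreeBelow-mono {f = m} e<D (proj₂ deg-m)
...   | no  e≮D = contradiction (deg-g (e ℕ.+ e) (ℕ.≤-trans (ℕ.≮⇒≥ e≮D) (ℕ.m≤m+n e e)))
  (proj₁ (HasDegree-cong (ℤ[X].sym g≈-m²)
    (HasDegree-neg {m * m} (HasDegree-* {m} {m} deg-m deg-m))))

-- Reducibility at odd indices.

odd⇒1+k+k : ∀ n → ¬ (2 ∣ n) → ∃ λ k → n ≡ suc (k ℕ.+ k)
odd⇒1+k+k zero          2∤n = contradiction (divides 0 ≡.refl) 2∤n
odd⇒1+k+k (suc zero)    2∤n = 0 , ≡.refl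
odd⇒1+k+k (suc (suc n)) 2∤n with odd⇒1+k+k n (λ 2∣n → 2∤n (∣m∣n⇒∣m+n ∣-refl 2∣n))
... | k , ≡.refl = suc k , ≡.cong (λ j → suc (suc j)) (≡.sym (ℕ.+-suc k k))

-- Degrees survive the passage to ℚ[X], where positive degree excludes units; a factorisation found
-- in ℤ[X] therefore suffices.
reducibleOverℚ : ∀ {f a b i j} → f ≋ a * b → HasDegree a i → HasDegree b j →
  0 < i → 0 < j → ReducibleOverℚ f
reducibleOverℚ {f} {a} {b} {i} {j} f≈ab deg-a deg-b 0<i 0<j =
    (λ f≈0 → proj₁ deg-f (f≈0 (i ℕ.+ j)))
  , ℚDomain.positive-degree⇒∤1 (ℕ.<-≤-trans 0<i (ℕ.m≤m+n i j)) deg-f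
  , toℚ[X] a , toℚ[X] b
  , (λ n → ≡.trans (toℚ[X]-cong f≈ab n) (≡.cong (λ h → ℚₚ.coeff h n) (toℚ[X]-homo-* a b)))
  , ℚDomain.positive-degree⇒∤1 0<i (toℚ[X]-HasDegree {a} deg-a)
  , ℚDomain.positive-degree⇒∤1 0<j (toℚ[X]-HasDegree {b} deg-b)
  where
  deg-f : ℚₚ.HasDegree (toℚ[X] f) (i ℕ.+ j)
  deg-f = toℚ[X]-HasDegree {f}
    (HasDegree-cong (ℤ[X].sym f≈ab) (HasDegree-* {a} {b} deg-a deg-b))

-- `1 < p` excludes `p` = 1, where `𝓕` is the unit 1. As `HasDegree` is a relation, deg `g` < deg
-- `d` is expressed over all pairs of degrees.
proposition3p3 : (d g : Polyℤ) → d ≉ 0# → g ≉ 0# → Coprime d g →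
    (∀ {i j} → HasDegree g i → HasDegree d j → i < j) →
    (m : Polyℤ) (p : ℕ) → ¬ (2 ∣ p) → 1 < p →
    g ≈ - (m * m) → ReducibleOverℚ (𝓕 d g p)
proposition3p3 d g d≉0 g≉0 _ deg-g<deg-d m p 2∤p 1<p g≈-m²
  with odd⇒1+k+k p 2∤p | zero-or-degree d | zero-or-degree g
... | _              | inj₁ d≈0         | _                = contradiction (coeffs d≈0) d≉0
... | _              | inj₂ _           | inj₁ g≈0         = contradiction (coeffs g≈0) g≉0
... | zero , ≡.refl  | inj₂ _           | inj₂ _           = contradiction 1<p (ℕ.<-irrefl ≡.refl)
-- Here `p` is 2(k + 1) + 1, and both factors have degree (k + 1)`D`.
... | suc k , ≡.refl | inj₂ (D , deg-d) | inj₂ (i , deg-g) =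
  reducibleOverℚ {𝓕 d g (suc (suc k ℕ.+ suc k))} {y + m * x} {y + - (m * x)}
    (𝓕-odd-factorisation d g m (suc k) (coeffwise g≈-m²))
    (HasDegree-+ˡ {y} {m * x} deg-y below-mx)
    (HasDegree-+ˡ {y} { - (m * x)} deg-y (DegreeBelow-neg {f = m * x} below-mx))
    0<kD 0<kD
  where
  x y : Polyℤ
  x = 𝓕 d g (suc k)
  y = 𝓕 d g (suc (suc k))

  i<D : i < D
  i<D = deg-g<deg-d deg-g deg-d

  0<kD : 0 < suc k ℕ.* D
  -- `D` is positive because it exceeds the degree `i` of `g`.
  0<kD = ℕ.<-≤-trans (ℕ.≤-<-trans z≤n i<D) (ℕ.m≤m+n D (k ℕ.* D))

  below-g : DegreeBelow D g
  below-g = DegreeBelow-mono {f = g} i<D (proj₂ deg-g)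

  deg-y : HasDegree y (suc k ℕ.* D)
  deg-y = 𝓕-HasDegree {d} {g} deg-d below-g (suc k)

  below-mx : DegreeBelow (suc k ℕ.* D) (m * x)
  -- Strictness comes from deg `m` < `D`, while `x` has degree exactly `k * D`; the sum `D + k * D`
  -- is `suc k * D` by computation.
  below-mx = DegreeBelow-* D (k ℕ.* D) m x
    (square-root-DegreeBelow {g} {m} (coeffwise g≈-m²) below-g)
    (proj₂ (𝓕-HasDegree {d} {g} deg-d below-g k))
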